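{- There is a constant $C>0$ such that every triangle-free graph with average degree $d$ and maximum degree $\Delta$ contains a bipartite induced subgraph of average degree at least $\frac{d}{C\Delta}\log \Delta$.
   Context: All graphs are finite and simple; $\log$ is the natural logarithm. -}

module Defs where

open import Data.Nat using (ℕ; _+_; _⊔_)
open import Data.Bool using (Bool; true; false; if_then_else_)
open import Data.Fin using (Fin)
open import Data.Fin.Subset using (Subset; _∈_)
open import Data.List using (List; map; foldr)
open import Data.Nat.ListAction using (sum)
open import Data.List using () renaming (allFin to allFinL)
open import Data.Vec using (lookup)
open import Data.Empty using (⊥)
open import Data.Product using (Σ)
open import Relation.Binary.PropositionalEquality using (_≡_; _≢_)

record Graph (n : ℕ) : Set where
  field
    adj    : Fin n → Fin n → Bool
    sym    : ∀ u v → adj u v ≡ adj v u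
    irrefl : ∀ v → adj v v ≡ false
open Graph public

degIn : ∀ {n} → Graph n → Subset n → Fin n → ℕ
degIn {n} G S v =
  sum (map (λ u → if lookup S u then (if adj G v u then 1 else 0) else 0) (allFinL n))

degSumIn : ∀ {n} → Graph n → Subset n → ℕ
degSumIn {n} G S =
  sum (map (λ v → if lookup S v then degIn G S v else 0) (allFinL n))

deg : ∀ {n} → Graph n → Fin n → ℕ
deg {n} G v = sum (map (λ u → if adj G v u then 1 else 0) (allFinL n))

-- sum of degrees of G (= 2 · |E(G)|); average degree d = degSum G / n
degSum : ∀ {n} → Graph n → ℕ
degSum {n} G = sum (map (deg G) (allFinL n))

maxDeg : ∀ {n} → Graph n → ℕ
maxDeg {n} G = foldr _⊔_ 0 (map (deg G) (allFinL n))

TriangleFree : ∀ {n} → Graph n → Set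
TriangleFree G = ∀ u v w → adj G u v ≡ true → adj G v w ≡ true → adj G u w ≡ true → ⊥

InducedBipartite : ∀ {n} → Graph n → Subset n → Set
InducedBipartite {n} G S =
  Σ (Fin n → Bool) λ col →
    ∀ u v → u ∈ S → v ∈ S → adj G u v ≡ true → col u ≢ col v

{-# OPTIONS --safe #-}

-- A uniformly random independent subset I of any set H ∋ v of vertices of a triangle-free
-- graph satisfies l ≤ 2·2^l·P(v ∈ I) + 2·E|N(v) ∩ I| (Shearer, Alon): conditioned on the
-- trace of I off N[v], if x neighbours of v remain free there are 2^x + 1 equally likely
-- outcomes, and l(2^x + 1) ≤ x 2^x + 2·2^l.  As this holds for every H, a greedy fractional
-- colouring shows that for all weights w some independent set I has
-- 4Δ·w(I) ≥ l·w(V), where l = ⌊log₂ Δ⌋.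
-- Applying this to w(u) = (8n·deg u − 4D)⁺, where D is the sum of the degrees, gives I, and
-- applying it to w(v) = (8nΔ·|N(v) ∩ I| − D l)⁺ gives J; then I ∪ J is the required set.
module Submission where

open import Defs renaming (sym to adj-sym)
open import Data.Bool using (Bool; true; false; if_then_else_)
open import Data.Bool.Properties as Bool using ()
open import Data.Fin using (Fin; zero; suc)
open import Data.Fin.Properties using (all?)
open import Data.Fin.Subset using (Subset; ∣_∣; _∈_; _⊆_; _∪_; _∩_; ∁; ⊥; ⁅_⁆)
open import Data.Fin.Subset.Properties
open import Data.List using (map; foldr) renaming (tabulate to tabulateL; allFin to allFinL)
open import Data.List.Properties using (map-tabulate)
open import Data.Nat using (ℕ; zero; suc; _+_; _*_; _∸_; _^_; _≤_; _<_; _⊔_; z≤n; s≤s; _≤?_; ⌊_/2⌋; NonZero; >-nonZero)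
open import Data.Nat.Induction using (<-rec)
open import Data.Nat.ListAction as List using ()
open import Data.Nat.Logarithm using (⌊log₂_⌋; ⌊log₂⌊n/2⌋⌋≡⌊log₂n⌋∸1)
open import Data.Nat.Properties
open import Data.Nat.Tactic.RingSolver using (solve-∀)
open import Data.Product using (Σ; ∃; _×_; _,_)
open import Data.Sum using (_⊎_; inj₁; inj₂; [_,_]′)
open import Data.Vec using ([]; _∷_; here; lookup; tabulate)
open import Data.Vec.Properties using ([]=⇒lookup; lookup⇒[]=; lookup∘tabulate)
open import Function using (_∘_; const; id)
open import Relation.Binary.PropositionalEquality using (_≡_; refl; sym; trans; cong; cong₂; subst; module ≡-Reasoning)
open import Relation.Nullary using (Dec; yes; no; does; ¬_; contradiction; _→-dec_; _×-dec_)
open import Relation.Nullary.Decidable using (dec-true; dec-false)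
open import Algebra.Properties.Semiring.Sum +-*-semiring using (sum; sum-cong-≗; ∑-distrib-+; ∑-comm; *-distribˡ-sum)

-- Sums over vertices and over subsets

𝟙 : Bool → ℕ
𝟙 b = if b then 1 else 0

sum-mono-≤ : ∀ {n} {f g : Fin n → ℕ} → (∀ i → f i ≤ g i) → sum f ≤ sum g
sum-mono-≤ {zero}  f≤g = z≤n
sum-mono-≤ {suc n} f≤g = +-mono-≤ (f≤g zero) (sum-mono-≤ (f≤g ∘ suc))

sum-const : ∀ n k → sum {n} (const k) ≡ n * k
sum-const zero    k = refl
sum-const (suc n) k = cong (k +_) (sum-const n k)

sum-map-allFin : ∀ {n} (f : Fin n → ℕ) → List.sum (map f (allFinL n)) ≡ sum f
sum-map-allFin {n} f = trans (cong List.sum (map-tabulate id f)) (go f)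
  where
  go : ∀ {m} (g : Fin m → ℕ) → List.sum (tabulateL g) ≡ sum g
  go {zero}  g = refl
  go {suc m} g = cong (g zero +_) (go (g ∘ suc))

∣∣≡sum : ∀ {n} (p : Subset n) → ∣ p ∣ ≡ sum (𝟙 ∘ lookup p)
∣∣≡sum []          = refl
∣∣≡sum (true ∷ p)  = cong suc (∣∣≡sum p)
∣∣≡sum (false ∷ p) = ∣∣≡sum p

∈-tabulate⁺ : ∀ {n} (f : Fin n → Bool) {i} → f i ≡ true → i ∈ tabulate f
∈-tabulate⁺ f {i} eq = lookup⇒[]= i (tabulate f) (trans (lookup∘tabulate f i) eq)

∈-tabulate⁻ : ∀ {n} (f : Fin n → Bool) {i} → i ∈ tabulate f → f i ≡ true
∈-tabulate⁻ f {i} i∈ = trans (sym (lookup∘tabulate f i)) ([]=⇒lookup i∈)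

𝟙-∈ : ∀ {n} {p : Subset n} {i} → i ∈ p → 𝟙 (lookup p i) ≡ 1
𝟙-∈ i∈p = cong 𝟙 ([]=⇒lookup i∈p)

𝟙-mono : ∀ {n} (p q : Subset n) i → (i ∈ p → i ∈ q) → 𝟙 (lookup p i) ≤ 𝟙 (lookup q i)
𝟙-mono p q i p⇒q with lookup p i in eq
... | false = z≤n
... | true  = ≤-reflexive (sym (𝟙-∈ (p⇒q (lookup⇒[]= i p eq))))

-- Expectations over random sets are kept unnormalised, as sums over the power set of `M`, so that
-- all arithmetic stays in ℕ.
sumSub : ∀ {n} → Subset n → (Subset n → ℕ) → ℕ
sumSub []          f = f []
sumSub (true ∷ M)  f = sumSub M (f ∘ (false ∷_)) + sumSub M (f ∘ (true ∷_))
sumSub (false ∷ M) f = sumSub M (f ∘ (false ∷_))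

sumSub-mono : ∀ {n} (M : Subset n) {f g} → (∀ Y → Y ⊆ M → f Y ≤ g Y) → sumSub M f ≤ sumSub M g
sumSub-mono []          h = h [] id
sumSub-mono (true ∷ M)  h =
  +-mono-≤ (sumSub-mono M λ Y Y⊆ → h _ (out⊆ Y⊆)) (sumSub-mono M λ Y Y⊆ → h _ (in⊆in Y⊆))
sumSub-mono (false ∷ M) h = sumSub-mono M λ Y Y⊆ → h _ (out⊆ Y⊆)

sumSub-cong : ∀ {n} (M : Subset n) {f g} → (∀ Y → Y ⊆ M → f Y ≡ g Y) → sumSub M f ≡ sumSub M g
sumSub-cong M h = ≤-antisym (sumSub-mono M λ Y Y⊆ → ≤-reflexive (h Y Y⊆))
                            (sumSub-mono M λ Y Y⊆ → ≤-reflexive (sym (h Y Y⊆)))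

sumSub-+ : ∀ {n} (M : Subset n) f g → sumSub M (λ Y → f Y + g Y) ≡ sumSub M f + sumSub M g
sumSub-+ []          f g = refl
sumSub-+ (false ∷ M) f g = sumSub-+ M _ _
sumSub-+ (true ∷ M)  f g =
  trans (cong₂ _+_ (sumSub-+ M _ _) (sumSub-+ M _ _))
        (interchange (sumSub M (f ∘ (false ∷_))) _ _ _)
  where
  interchange : ∀ a b c d → a + b + (c + d) ≡ a + c + (b + d)
  interchange = solve-∀

sumSub-* : ∀ {n} (M : Subset n) k f → sumSub M (λ Y → k * f Y) ≡ k * sumSub M f
sumSub-* []          k f = refl
sumSub-* (false ∷ M) k f = sumSub-* M k _
sumSub-* (true ∷ M)  k f =
  trans (cong₂ _+_ (sumSub-* M k _) (sumSub-* M k _)) (sym (*-distribˡ-+ k _ _))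

sumSub-const : ∀ {n} (M : Subset n) k → sumSub M (const k) ≡ k * 2 ^ ∣ M ∣
sumSub-const []          k = sym (*-identityʳ k)
sumSub-const (false ∷ M) k = sumSub-const M k
sumSub-const (true ∷ M)  k = trans (cong₂ _+_ (sumSub-const M k) (sumSub-const M k)) (double k (2 ^ ∣ M ∣))
  where
  double : ∀ k x → k * x + k * x ≡ k * (2 * x)
  double = solve-∀

-- A uniformly random subset contains half of `M` on average; doubling avoids the fraction.
2*sumSub-∣∣ : ∀ {n} (M : Subset n) → 2 * sumSub M ∣_∣ ≡ ∣ M ∣ * 2 ^ ∣ M ∣
2*sumSub-∣∣ []          = refl
2*sumSub-∣∣ (false ∷ M) = 2*sumSub-∣∣ M
2*sumSub-∣∣ (true ∷ M)  =
  trans (cong (λ z → 2 * (sumSub M ∣_∣ + z)) (trans (sumSub-+ M (const 1) ∣_∣) (cong (_+ sumSub M ∣_∣) (sumSub-const M 1))))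
    (trans (regroup (sumSub M ∣_∣) (2 ^ ∣ M ∣))
      (trans (cong (λ z → 2 * z + 2 * 2 ^ ∣ M ∣) (2*sumSub-∣∣ M)) (collect ∣ M ∣ (2 ^ ∣ M ∣))))
  where
  regroup : ∀ s p → 2 * (s + (1 * p + s)) ≡ 2 * (2 * s) + 2 * p
  regroup = solve-∀
  collect : ∀ x p → 2 * (x * p) + 2 * p ≡ (1 + x) * (2 * p)
  collect = solve-∀

sumSub-sum : ∀ {n m} (M : Subset n) (f : Fin m → Subset n → ℕ) →
  sumSub M (λ Y → sum (λ i → f i Y)) ≡ sum (λ i → sumSub M (f i))
sumSub-sum {m = zero}  M f = sumSub-const M 0
sumSub-sum {m = suc m} M f =
  trans (sumSub-+ M (f zero) _) (cong (sumSub M (f zero) +_) (sumSub-sum M (f ∘ suc)))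

-- Conditioning on the trace outside `B`: a subset of `M` is uniquely a part off `B` together with a
-- part inside `B`.
sumSub-split : ∀ {n} (M B : Subset n) f →
  sumSub M f ≡ sumSub (M ∩ ∁ B) (λ J → sumSub (M ∩ B) (λ Y → f (J ∪ Y)))
sumSub-split []          []          f = refl
sumSub-split (false ∷ M) (b ∷ B)     f = sumSub-split M B _
sumSub-split (true ∷ M)  (false ∷ B) f = cong₂ _+_ (sumSub-split M B _) (sumSub-split M B _)
sumSub-split (true ∷ M)  (true ∷ B)  f =
  trans (cong₂ _+_ (sumSub-split M B _) (sumSub-split M B _)) (sym (sumSub-+ (M ∩ ∁ B) _ _))

sumSub-restrict : ∀ {n} (M X : Subset n) {f} → X ⊆ M →
  (∀ Y → Y ⊆ M → ¬ (Y ⊆ X) → f Y ≡ 0) → sumSub M f ≡ sumSub X f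
sumSub-restrict []          []          X⊆M h = refl
sumSub-restrict (false ∷ M) (true ∷ X)  X⊆M h = contradiction (X⊆M here) λ ()
sumSub-restrict (false ∷ M) (false ∷ X) X⊆M h =
  sumSub-restrict M X (drop-∷-⊆ X⊆M) λ Y Y⊆M Y⊈X → h _ (out⊆ Y⊆M) (Y⊈X ∘ drop-∷-⊆)
sumSub-restrict (true ∷ M)  (true ∷ X)  X⊆M h = cong₂ _+_
  (sumSub-restrict M X (drop-∷-⊆ X⊆M) λ Y Y⊆M Y⊈X → h _ (out⊆ Y⊆M) (Y⊈X ∘ drop-∷-⊆))
  (sumSub-restrict M X (drop-∷-⊆ X⊆M) λ Y Y⊆M Y⊈X → h _ (in⊆in Y⊆M) (Y⊈X ∘ drop-∷-⊆))
sumSub-restrict (true ∷ M)  (false ∷ X) X⊆M h = trans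
  (cong₂ _+_
    (sumSub-restrict M X (drop-∷-⊆ X⊆M) λ Y Y⊆M Y⊈X → h _ (out⊆ Y⊆M) (Y⊈X ∘ drop-∷-⊆))
    (trans (sumSub-cong M λ Y Y⊆M → h _ (in⊆in Y⊆M) λ iY⊆ → contradiction (iY⊆ here) λ ()) (sumSub-const M 0)))
  (+-identityʳ _)

sumSub-term : ∀ {n} (M Y : Subset n) f → Y ⊆ M → f Y ≤ sumSub M f
sumSub-term []          []          f Y⊆M = ≤-refl
sumSub-term (true ∷ M)  (true ∷ Y)  f Y⊆M = ≤-trans (sumSub-term M Y _ (drop-∷-⊆ Y⊆M)) (m≤n+m _ _)
sumSub-term (true ∷ M)  (false ∷ Y) f Y⊆M = ≤-trans (sumSub-term M Y _ (drop-∷-⊆ Y⊆M)) (m≤m+n _ _)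
sumSub-term (false ∷ M) (true ∷ Y)  f Y⊆M = contradiction (Y⊆M here) λ ()
sumSub-term (false ∷ M) (false ∷ Y) f Y⊆M = sumSub-term M Y _ (drop-∷-⊆ Y⊆M)

sumSub-⊥ : ∀ {n} f → sumSub {n} ⊥ f ≡ f ⊥
sumSub-⊥ {zero}  f = refl
sumSub-⊥ {suc n} f = sumSub-⊥ (f ∘ (false ∷_))

sumSub-⁅⁆ : ∀ {n} (v : Fin n) f → sumSub ⁅ v ⁆ f ≡ f ⊥ + f ⁅ v ⁆
sumSub-⁅⁆ zero    f = cong₂ _+_ (sumSub-⊥ (f ∘ (false ∷_))) (sumSub-⊥ (f ∘ (true ∷_)))
sumSub-⁅⁆ (suc v) f = sumSub-⁅⁆ v (f ∘ (false ∷_))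

sumSub-insert : ∀ {n} (M : Subset n) {v} f → v ∈ M →
  sumSub M f ≡ sumSub (M ∩ ∁ ⁅ v ⁆) (λ J → f J + f (J ∪ ⁅ v ⁆))
sumSub-insert M {v} f v∈M = trans (sumSub-split M ⁅ v ⁆ f) (sumSub-cong (M ∩ ∁ ⁅ v ⁆) λ J _ →
  trans (cong (λ P → sumSub P (λ Y → f (J ∪ Y))) M∩v≡v)
    (trans (sumSub-⁅⁆ v (λ Y → f (J ∪ Y))) (cong (λ P → f P + f (J ∪ ⁅ v ⁆)) (∪-identityʳ J))))
  where
  M∩v≡v : M ∩ ⁅ v ⁆ ≡ ⁅ v ⁆
  M∩v≡v = ⊆-antisym (p∩q⊆q M ⁅ v ⁆) λ x∈ → x∈p∩q⁺ (subst (_∈ M) (sym (x∈⁅y⁆⇒x≡y v x∈)) v∈M , x∈)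

-- Powers of two and the binary logarithm

n≤2^n : ∀ n → n ≤ 2 ^ n
n≤2^n zero    = z≤n
n≤2^n (suc n) = ≤-trans (+-mono-≤ (m^n>0 2 n) (n≤2^n n)) (≤-reflexive (cong (2 ^ n +_) (sym (+-identityʳ _))))

-- Strong induction through `⌊ n /2⌋`, whose logarithm is one less.
2^⌊log₂n⌋≤n : ∀ n → 0 < n → 2 ^ ⌊log₂ n ⌋ ≤ n
2^⌊log₂n⌋≤n = <-rec _ step
  where
  open ≤-Reasoning
  step : ∀ n → (∀ {m} → m < n → 0 < m → 2 ^ ⌊log₂ m ⌋ ≤ m) → 0 < n → 2 ^ ⌊log₂ n ⌋ ≤ n
  step 1 rec _ = ≤-refl
  step n@(suc (suc k)) rec _ = halve ⌊log₂ n ⌋ (⌊log₂⌊n/2⌋⌋≡⌊log₂n⌋∸1 n)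
    where
    halve : ∀ l → ⌊log₂ ⌊ n /2⌋ ⌋ ≡ l ∸ 1 → 2 ^ l ≤ n
    -- For l = 0 the truncated `l ∸ 1` carries no information, but the bound is immediate.
    halve zero    _  = s≤s z≤n
    halve (suc l) eq = begin
      2 ^ l + (2 ^ l + 0)      ≤⟨ +-mono-≤ half (+-monoˡ-≤ 0 half) ⟩
      ⌊ n /2⌋ + (⌊ n /2⌋ + 0)  ≡⟨ cong (⌊ n /2⌋ +_) (+-identityʳ _) ⟩
      ⌊ n /2⌋ + ⌊ n /2⌋        ≤⟨ +-monoʳ-≤ ⌊ n /2⌋ (⌊n/2⌋≤⌈n/2⌉ n) ⟩
      ⌊ n /2⌋ + _              ≡⟨ ⌊n/2⌋+⌈n/2⌉≡n n ⟩
      n                        ∎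
      where
      half : 2 ^ l ≤ ⌊ n /2⌋
      half = subst (λ z → 2 ^ z ≤ ⌊ n /2⌋) eq (rec (⌊n/2⌋<n (suc k)) (s≤s z≤n))

-- With l = x + k, use k ≤ 2 ^ k.
entropy-bound : ∀ l x → l * 2 ^ x + l ≤ x * 2 ^ x + 2 * 2 ^ l
entropy-bound l x = begin
  l * 2 ^ x + l                      ≤⟨ +-mono-≤ main (n≤2^n l) ⟩
  x * 2 ^ x + 2 ^ l + 2 ^ l          ≡⟨ assoc (x * 2 ^ x) (2 ^ l) ⟩
  x * 2 ^ x + 2 * 2 ^ l              ∎
  where
  open ≤-Reasoning
  assoc : ∀ a b → a + b + b ≡ a + 2 * b
  assoc = solve-∀
  main : l * 2 ^ x ≤ x * 2 ^ x + 2 ^ l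
  main with ≤-total l x
  ... | inj₁ l≤x = ≤-trans (*-monoˡ-≤ (2 ^ x) l≤x) (m≤m+n _ _)
  ... | inj₂ x≤l with k , refl ← m≤n⇒∃[o]m+o≡n x≤l = begin
    (x + k) * 2 ^ x             ≡⟨ *-distribʳ-+ (2 ^ x) x k ⟩
    x * 2 ^ x + k * 2 ^ x       ≤⟨ +-monoʳ-≤ (x * 2 ^ x) (*-monoˡ-≤ (2 ^ x) (n≤2^n k)) ⟩
    x * 2 ^ x + 2 ^ k * 2 ^ x   ≡⟨ cong (x * 2 ^ x +_) (trans (*-comm (2 ^ k) _) (sym (^-distribˡ-+-* 2 x k))) ⟩
    x * 2 ^ x + 2 ^ (x + k)     ∎

-- Independent sets

does-true⁻ : ∀ {A : Set} (a? : Dec A) → does a? ≡ true → A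
does-true⁻ (yes a) _ = a

Independent : ∀ {n} → Graph n → Subset n → Set
Independent G I = ∀ u v → u ∈ I → v ∈ I → adj G u v ≡ false

independent? : ∀ {n} (G : Graph n) I → Dec (Independent G I)
independent? G I = all? λ u → all? λ v → (u ∈? I) →-dec ((v ∈? I) →-dec (adj G u v Bool.≟ false))

Independent-⊆ : ∀ {n} (G : Graph n) {I J} → I ⊆ J → Independent G J → Independent G I
Independent-⊆ G I⊆J indJ u v u∈I v∈I = indJ u v (I⊆J u∈I) (I⊆J v∈I)

Independent-⊥ : ∀ {n} (G : Graph n) → Independent G ⊥
Independent-⊥ G u v u∈⊥ = contradiction u∈⊥ ∉⊥

Independent-⁅⁆ : ∀ {n} (G : Graph n) v → Independent G ⁅ v ⁆
Independent-⁅⁆ G v a b a∈ b∈ with refl ← x∈⁅y⁆⇒x≡y v a∈ | refl ← x∈⁅y⁆⇒x≡y v b∈ = irrefl G v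

Independent-∪ : ∀ {n} (G : Graph n) I J → Independent G I → Independent G J →
  (∀ u v → u ∈ I → v ∈ J → adj G u v ≡ false) → Independent G (I ∪ J)
Independent-∪ G I J indI indJ cross u v u∈ v∈ with x∈p∪q⁻ I J u∈ | x∈p∪q⁻ I J v∈
... | inj₁ u∈I | inj₁ v∈I = indI u v u∈I v∈I
... | inj₁ u∈I | inj₂ v∈J = cross u v u∈I v∈J
... | inj₂ u∈J | inj₁ v∈I = trans (adj-sym G u v) (cross v u v∈I u∈J)
... | inj₂ u∈J | inj₂ v∈J = indJ u v u∈J v∈J

ind : ∀ {n} → Graph n → Subset n → ℕ
ind G I = 𝟙 (does (independent? G I))

ind-yes : ∀ {n} (G : Graph n) {I} → Independent G I → ind G I ≡ 1
ind-yes G {I} indI = cong 𝟙 (dec-true (independent? G I) indI)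

ind-no : ∀ {n} (G : Graph n) {I} → ¬ Independent G I → ind G I ≡ 0
ind-no G {I} ¬indI = cong 𝟙 (dec-false (independent? G I) ¬indI)

indepCount : ∀ {n} → Graph n → Subset n → ℕ
indepCount G H = sumSub H (ind G)

indepCountAt : ∀ {n} → Graph n → Subset n → Fin n → ℕ
indepCountAt G H u = sumSub H (λ I → ind G I * 𝟙 (lookup I u))

-- For demands c proportional to the occupation probabilities of a random
-- independent set, this is 2·2^l·P(v ∈ I) + 2·E|N(v) ∩ I| up to scaling.
load : ∀ {n} → Graph n → ℕ → (Fin n → ℕ) → Fin n → ℕ
load G l c v = 2 * 2 ^ l * c v + 2 * sum (λ u → 𝟙 (adj G v u) * c u)

-- Local occupancy in a triangle-free graph

module _ {n} (G : Graph n) (tf : TriangleFree G) where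

  private
    nonadjacent : ∀ {u v} → ¬ (adj G u v ≡ true) → adj G u v ≡ false
    nonadjacent = Bool.¬-not

  module Local (H : Subset n) {v : Fin n} (v∈H : v ∈ H) (l : ℕ) where
    private
      A R P : Subset n
      A = tabulate (adj G v)
      R = H ∩ ∁ A
      P = H ∩ A

      v∈R : v ∈ R
      v∈R = x∈p∩q⁺ (v∈H , x∉p⇒x∈∁p λ v∈A → contradiction (trans (sym (∈-tabulate⁻ (adj G v) v∈A)) (irrefl G v)) λ ())

      P⇒adj : ∀ {u} → u ∈ P → adj G v u ≡ true
      P⇒adj u∈P = ∈-tabulate⁻ (adj G v) (p∩q⊆q H A u∈P)

      -- The point where triangle-freeness enters: an edge between two neighbours of `v` would close
      -- a triangle.
      Independent-P : ∀ {Y} → Y ⊆ P → Independent G Y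
      Independent-P Y⊆P a b a∈ b∈ = nonadjacent λ ab → tf v a b (P⇒adj (Y⊆P a∈)) ab (P⇒adj (Y⊆P b∈))

      -- Two successive conditionings: `J` is the trace off the closed neighbourhood of `v`, and the
      -- inner sums run over the sets avoiding and containing `v`.
      decompose : ∀ f → sumSub H f ≡ sumSub (R ∩ ∁ ⁅ v ⁆) (λ J →
        sumSub P (λ Y → f (J ∪ Y)) + sumSub P (λ Y → f ((J ∪ ⁅ v ⁆) ∪ Y)))
      decompose f = trans (sumSub-split H A f) (sumSub-insert R (λ J → sumSub P (λ Y → f (J ∪ Y))) v∈R)

      φ : Subset n → ℕ
      φ I = load G l (λ u → 𝟙 (lookup I u)) v

      module Trace (J : Subset n) (J⊆ : J ⊆ R ∩ ∁ ⁅ v ⁆) (indJ : Independent G J) where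
        J-nonadj : ∀ {u} → u ∈ J → adj G u v ≡ false
        J-nonadj {u} u∈J = trans (adj-sym G u v) (nonadjacent λ vu →
          x∈∁p⇒x∉p (p∩q⊆q H (∁ A) (p∩q⊆p R (∁ ⁅ v ⁆) (J⊆ u∈J))) (∈-tabulate⁺ (adj G v) vu))

        -- In a triangle-free graph the independent extensions of J by subsets of N[v]
        -- are J ∪ {v} and J ∪ Y with Y an arbitrary set of free neighbours.
        free : Fin n → Bool
        free u = does (independent? G (J ∪ ⁅ u ⁆))

        X : Subset n
        X = P ∩ tabulate free

        X⊆P : X ⊆ P
        X⊆P = p∩q⊆p P (tabulate free)

        extend : ∀ {Y} → Y ⊆ X → Independent G (J ∪ Y)
        extend {Y} Y⊆X = Independent-∪ G J Y indJ (Independent-P (X⊆P ∘ Y⊆X)) λ a b a∈J b∈Y →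
          does-true⁻ (independent? G (J ∪ ⁅ b ⁆)) (∈-tabulate⁻ free (p∩q⊆q P (tabulate free) (Y⊆X b∈Y)))
            a b (p⊆p∪q ⁅ b ⁆ a∈J) (q⊆p∪q J ⁅ b ⁆ (x∈⁅x⁆ b))

        extend⁻ : ∀ {Y} → Y ⊆ P → Independent G (J ∪ Y) → Y ⊆ X
        extend⁻ {Y} Y⊆P indJY {u} u∈Y = x∈p∩q⁺ (Y⊆P u∈Y , ∈-tabulate⁺ free (dec-true (independent? G (J ∪ ⁅ u ⁆))
          (Independent-⊆ G J∪u⊆J∪Y indJY)))
          where
          J∪u⊆J∪Y : J ∪ ⁅ u ⁆ ⊆ J ∪ Y
          J∪u⊆J∪Y x∈ with x∈p∪q⁻ J ⁅ u ⁆ x∈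
          ... | inj₁ x∈J = p⊆p∪q Y x∈J
          ... | inj₂ x∈u = q⊆p∪q J Y (subst (_∈ Y) (sym (x∈⁅y⁆⇒x≡y u x∈u)) u∈Y)

        sum-without-v : ∀ (F : Subset n → ℕ) → sumSub P (λ Y → ind G (J ∪ Y) * F Y) ≡ sumSub X F
        sum-without-v F = trans
          (sumSub-restrict P X X⊆P λ Y Y⊆P Y⊈X → cong (_* F Y) (ind-no G (λ indJY → Y⊈X (extend⁻ Y⊆P indJY))))
          (sumSub-cong X λ Y Y⊆X → trans (cong (_* F Y) (ind-yes G (extend Y⊆X))) (*-identityˡ _))

        Independent-J∪v : Independent G (J ∪ ⁅ v ⁆)
        Independent-J∪v = Independent-∪ G J ⁅ v ⁆ indJ (Independent-⁅⁆ G v) λ a b a∈J b∈v →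
          subst (λ z → adj G a z ≡ false) (sym (x∈⁅y⁆⇒x≡y v b∈v)) (J-nonadj a∈J)

        -- Once `v` is in the set no neighbour can join it, so only the empty `Y` survives.
        sum-with-v : ∀ (F : Subset n → ℕ) → sumSub P (λ Y → ind G ((J ∪ ⁅ v ⁆) ∪ Y) * F Y) ≡ F ⊥
        sum-with-v F = trans (sumSub-restrict P ⊥ ⊥⊆ vanish) (trans (sumSub-⊥ (λ Y → ind G ((J ∪ ⁅ v ⁆) ∪ Y) * F Y))
          (trans (cong (_* F ⊥) (ind-yes G (subst (Independent G) (sym (∪-identityʳ _)) Independent-J∪v))) (*-identityˡ _)))
          where
          vanish : ∀ Y → Y ⊆ P → ¬ (Y ⊆ ⊥) → ind G ((J ∪ ⁅ v ⁆) ∪ Y) * F Y ≡ 0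
          vanish Y Y⊆P Y⊈⊥ = cong (_* F Y) (ind-no G λ indep → Y⊈⊥ λ {u} u∈Y →
            contradiction (trans (sym (P⇒adj (Y⊆P u∈Y)))
              (indep v u (p⊆p∪q Y (q⊆p∪q J ⁅ v ⁆ (x∈⁅x⁆ v))) (q⊆p∪q (J ∪ ⁅ v ⁆) Y u∈Y))) λ ())

        -- Sets without `v` pay through the neighbour term of `load` alone: every element of `Y` is
        -- a neighbour of `v`.
        2∣Y∣≤φ : ∀ Y → Y ⊆ X → 2 * ∣ Y ∣ ≤ φ (J ∪ Y)
        2∣Y∣≤φ Y Y⊆X = ≤-trans (*-monoʳ-≤ 2 (≤-trans (≤-reflexive (∣∣≡sum Y)) (sum-mono-≤ pointwise)))
          (m≤n+m _ (2 * 2 ^ l * 𝟙 (lookup (J ∪ Y) v)))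
          where
          pointwise : ∀ u → 𝟙 (lookup Y u) ≤ 𝟙 (adj G v u) * 𝟙 (lookup (J ∪ Y) u)
          pointwise u with lookup Y u in eq
          ... | false = z≤n
          ... | true rewrite P⇒adj (X⊆P (Y⊆X (lookup⇒[]= u Y eq)))
                           | []=⇒lookup (q⊆p∪q J Y (lookup⇒[]= u Y eq)) = ≤-refl

        -- The set with `v` pays through the vertex term of `load` alone.
        2^l≤φ : 2 * 2 ^ l ≤ φ ((J ∪ ⁅ v ⁆) ∪ ⊥)
        2^l≤φ = ≤-trans (≤-reflexive (trans (sym (*-identityʳ _))
                  (cong (2 * 2 ^ l *_) (sym (𝟙-∈ (p⊆p∪q ⊥ (q⊆p∪q J ⁅ v ⁆ (x∈⁅x⁆ v)))))))) (m≤m+n _ _)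

        bound : sumSub P (λ Y → ind G (J ∪ Y) * l) + sumSub P (λ Y → ind G ((J ∪ ⁅ v ⁆) ∪ Y) * l)
              ≤ sumSub P (λ Y → ind G (J ∪ Y) * φ (J ∪ Y)) + sumSub P (λ Y → ind G ((J ∪ ⁅ v ⁆) ∪ Y) * φ ((J ∪ ⁅ v ⁆) ∪ Y))
        bound = begin
          _
            ≡⟨ cong₂ _+_ (sum-without-v (const l)) (sum-with-v (const l)) ⟩
          sumSub X (const l) + l                         ≡⟨ cong (_+ l) (sumSub-const X l) ⟩
          l * 2 ^ ∣ X ∣ + l                              ≤⟨ entropy-bound l ∣ X ∣ ⟩
          ∣ X ∣ * 2 ^ ∣ X ∣ + 2 * 2 ^ l
            ≡⟨ cong (_+ 2 * 2 ^ l) (trans (sumSub-* X 2 ∣_∣) (2*sumSub-∣∣ X)) ⟨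
          sumSub X (λ Y → 2 * ∣ Y ∣) + 2 * 2 ^ l         ≤⟨ +-mono-≤ (sumSub-mono X 2∣Y∣≤φ) 2^l≤φ ⟩
          sumSub X (λ Y → φ (J ∪ Y)) + φ ((J ∪ ⁅ v ⁆) ∪ ⊥)
            ≡⟨ cong₂ _+_ (sum-without-v (λ Y → φ (J ∪ Y))) (sum-with-v (λ Y → φ ((J ∪ ⁅ v ⁆) ∪ Y))) ⟨
          _                                              ∎
          where open ≤-Reasoning

      vanishing : ∀ {J Y} k m → ¬ Independent G J → J ⊆ Y → ind G Y * k ≤ m
      vanishing k m ¬indJ J⊆Y = ≤-trans (≤-reflexive (cong (_* k) (ind-no G (¬indJ ∘ Independent-⊆ G J⊆Y)))) z≤n

      summed : sumSub H (λ I → ind G I * l) ≤ sumSub H (λ I → ind G I * φ I)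
      summed = ≤-trans (≤-reflexive (decompose (λ I → ind G I * l)))
        (≤-trans (sumSub-mono (R ∩ ∁ ⁅ v ⁆) each) (≤-reflexive (sym (decompose (λ I → ind G I * φ I)))))
        where
        each : ∀ J → J ⊆ R ∩ ∁ ⁅ v ⁆ → _
        each J J⊆ with independent? G J
        ... | yes indJ = Trace.bound J J⊆ indJ
        -- Every extension of a dependent `J` is dependent, so the left side vanishes.
        ... | no ¬indJ = +-mono-≤
          (sumSub-mono P λ Y _ → vanishing l _ ¬indJ (p⊆p∪q Y))
          (sumSub-mono P λ Y _ → vanishing l _ ¬indJ (λ x∈ → p⊆p∪q Y (p⊆p∪q ⁅ v ⁆ x∈)))

      sum-φ : sumSub H (λ I → ind G I * φ I) ≡ load G l (indepCountAt G H) v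
      sum-φ = trans (sumSub-cong H λ I _ → expand I)
        (trans (sumSub-+ H _ _) (cong₂ _+_ (sumSub-* H (2 * 2 ^ l) _)
          (trans (sumSub-* H 2 _) (cong (2 *_) (trans
            (sumSub-sum H (λ u I → 𝟙 (adj G v u) * (ind G I * 𝟙 (lookup I u))))
            (sum-cong-≗ λ u → sumSub-* H (𝟙 (adj G v u)) _))))))
        where
        swap : ∀ i a x → i * (a * x) ≡ a * (i * x)
        swap = solve-∀
        expand : ∀ I → ind G I * φ I ≡
          2 * 2 ^ l * (ind G I * 𝟙 (lookup I v)) + 2 * sum (λ u → 𝟙 (adj G v u) * (ind G I * 𝟙 (lookup I u)))
        expand I = trans (*-distribˡ-+ (ind G I) _ _) (cong₂ _+_ (swap (ind G I) (2 * 2 ^ l) _)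
          (trans (swap (ind G I) 2 _) (cong (2 *_) (trans (*-distribˡ-sum (ind G I) (λ u → 𝟙 (adj G v u) * 𝟙 (lookup I u)))
            (sum-cong-≗ λ u → swap (ind G I) (𝟙 (adj G v u)) _)))))

    -- Divided by `indepCount G H`, this reads l ≤ 2·2^l·P(v ∈ I) + 2·E|N(v) ∩ I| for a uniformly
    -- random independent `I` inside `H`.
    local-bound : l * indepCount G H ≤ load G l (indepCountAt G H) v
    local-bound = begin
      l * indepCount G H                 ≡⟨ sumSub-* H l (ind G) ⟨
      sumSub H (λ I → l * ind G I)       ≡⟨ sumSub-cong H (λ I _ → *-comm l (ind G I)) ⟩
      sumSub H (λ I → ind G I * l)       ≤⟨ summed ⟩
      sumSub H (λ I → ind G I * φ I)     ≡⟨ sum-φ ⟩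
      load G l (indepCountAt G H) v      ∎
      where open ≤-Reasoning

-- Weighted independent sets

-- Transitivity is asked only through a middle element satisfying `P`: the relation of interest
-- compares fractions by cross-multiplication, which needs a positive middle denominator.
minimum : ∀ {n} {P : Fin n → Set} {R : Fin n → Fin n → Set} → (∀ v → Dec (P v)) →
  (∀ u v → R u v ⊎ R v u) → (∀ {u v w} → P v → R u v → R v w → R u w) →
  (∀ v → ¬ P v) ⊎ (∃ λ m → P m × (∀ v → P v → R m v))
minimum {zero}          P? total transR = inj₁ λ ()
minimum {suc n} {P} {R} P? total transR
  with P? zero | minimum {n} {P ∘ suc} {λ u v → R (suc u) (suc v)} (P? ∘ suc) (λ u v → total (suc u) (suc v)) transR
... | no ¬P0 | inj₁ none = inj₁ λ { zero → ¬P0 ; (suc v) → none v }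
... | no ¬P0 | inj₂ (m , Pm , min) =
  inj₂ (suc m , Pm , λ { zero P0 → contradiction P0 ¬P0 ; (suc v) → min v })
... | yes P0 | inj₁ none =
  inj₂ (zero , P0 , λ { zero _ → [ id , id ]′ (total zero zero) ; (suc v) Pv → contradiction Pv (none v) })
... | yes P0 | inj₂ (m , Pm , min) with total zero (suc m)
...   | inj₁ 0Rm =
  inj₂ (zero , P0 , λ { zero _ → [ id , id ]′ (total zero zero) ; (suc v) Pv → transR Pm 0Rm (min v Pv) })
...   | inj₂ mR0 = inj₂ (suc m , Pm , λ { zero _ → mR0 ; (suc v) → min v })

supp : ∀ {n} → (Fin n → ℕ) → Subset n
supp c = tabulate (λ v → does (1 ≤? c v))

∈-supp⁺ : ∀ {n} (c : Fin n → ℕ) {v} → 0 < c v → v ∈ supp c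
∈-supp⁺ c {v} 0<c = ∈-tabulate⁺ _ (dec-true (1 ≤? c v) 0<c)

∈-supp⁻ : ∀ {n} (c : Fin n → ℕ) {v} → v ∈ supp c → 0 < c v
∈-supp⁻ c {v} v∈ = does-true⁻ (1 ≤? c v) (∈-tabulate⁻ _ v∈)

-- The hypothesis expresses c′ = b·c - a·d without truncated subtraction, and linearity carries it
-- over to weighted sums.
sum-combine : ∀ {n} (x c c′ d : Fin n → ℕ) a b → (∀ u → c′ u + a * d u ≡ b * c u) →
  sum (λ u → x u * c′ u) + a * sum (λ u → x u * d u) ≡ b * sum (λ u → x u * c u)
sum-combine x c c′ d a b h = begin
  sum (λ u → x u * c′ u) + a * sum (λ u → x u * d u)
    ≡⟨ cong (sum (λ u → x u * c′ u) +_) (*-distribˡ-sum a (λ u → x u * d u)) ⟩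
  sum (λ u → x u * c′ u) + sum (λ u → a * (x u * d u))
    ≡⟨ ∑-distrib-+ (λ u → x u * c′ u) (λ u → a * (x u * d u)) ⟨
  sum (λ u → x u * c′ u + a * (x u * d u))
    ≡⟨ sum-cong-≗ (λ u → trans (factor (x u) (c′ u) a (d u)) (trans (cong (x u *_) (h u)) (swap (x u) b (c u)))) ⟩
  sum (λ u → b * (x u * c u))                                ≡⟨ *-distribˡ-sum b (λ u → x u * c u) ⟨
  b * sum (λ u → x u * c u)                                  ∎
  where
  open ≡-Reasoning
  factor : ∀ x c a d → x * c + a * (x * d) ≡ x * (c + a * d)
  factor = solve-∀
  swap : ∀ x b c → x * (b * c) ≡ b * (x * c)
  swap = solve-∀

load-combine : ∀ {n} (G : Graph n) l (c c′ d : Fin n → ℕ) a b → (∀ u → c′ u + a * d u ≡ b * c u) →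
  ∀ v → load G l c′ v + a * load G l d v ≡ b * load G l c v
load-combine G l c c′ d a b h v = trans (regroup (2 * 2 ^ l) (c′ v) a (d v) (S c′) (S d))
  (trans (cong₂ (λ y z → 2 * 2 ^ l * y + 2 * z) (h v) (sum-combine (𝟙 ∘ adj G v) c c′ d a b h))
    (factor (2 * 2 ^ l) b (c v) (S c)))
  where
  S : (Fin _ → ℕ) → ℕ
  S e = sum (λ u → 𝟙 (adj G v u) * e u)
  regroup : ∀ p c a d s t → p * c + 2 * s + a * (p * d + 2 * t) ≡ p * (c + a * d) + 2 * (s + a * t)
  regroup = solve-∀
  factor : ∀ p b c s → p * (b * c) + 2 * (b * s) ≡ b * (p * c + 2 * s)
  factor = solve-∀

wt : ∀ {n} → (Fin n → ℕ) → Subset n → ℕ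
wt w I = sum (λ u → 𝟙 (lookup I u) * w u)

-- The singleton of `v` is one of the sets counted; positivity lets these counts be cancelled.
indepCountAt>0 : ∀ {n} (G : Graph n) H {v} → v ∈ H → 0 < indepCountAt G H v
indepCountAt>0 G H {v} v∈H = ≤-trans
  (≤-reflexive (sym (cong₂ _*_ (ind-yes G (Independent-⁅⁆ G v)) (𝟙-∈ (x∈⁅x⁆ v)))))
  (sumSub-term H ⁅ v ⁆ (λ I → ind G I * 𝟙 (lookup I v)) λ x∈ → subst (_∈ H) (sym (x∈⁅y⁆⇒x≡y v x∈)) v∈H)

indepCountAt-∉ : ∀ {n} (G : Graph n) H {v} → ¬ (v ∈ H) → indepCountAt G H v ≡ 0
indepCountAt-∉ G H {v} v∉H = trans (sumSub-cong H vanish) (sumSub-const H 0)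
  where
  vanish : ∀ Y → Y ⊆ H → ind G Y * 𝟙 (lookup Y v) ≡ 0
  vanish Y Y⊆H with lookup Y v in eq
  ... | true  = contradiction (Y⊆H (lookup⇒[]= v Y eq)) v∉H
  ... | false = *-zeroʳ (ind G Y)

-- The mean weight of a random independent subset of `H` is at most the maximum, after
-- multiplication by the number of such subsets.
average-weight : ∀ {n} (G : Graph n) H (w : Fin n → ℕ) W → (∀ I → Independent G I → wt w I ≤ W) →
  sum (λ v → w v * indepCountAt G H v) ≤ W * indepCount G H
average-weight G H w W max = begin
  sum (λ v → w v * indepCountAt G H v)
    ≡⟨ sum-cong-≗ (λ v → sumSub-* H (w v) (λ I → ind G I * 𝟙 (lookup I v))) ⟨
  sum (λ v → sumSub H (λ I → w v * (ind G I * 𝟙 (lookup I v))))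
    ≡⟨ sumSub-sum H (λ v I → w v * (ind G I * 𝟙 (lookup I v))) ⟨
  sumSub H (λ I → sum (λ v → w v * (ind G I * 𝟙 (lookup I v))))      ≤⟨ sumSub-mono H each ⟩
  sumSub H (λ I → W * ind G I)                                       ≡⟨ sumSub-* H W (ind G) ⟩
  W * indepCount G H                                                 ∎
  where
  open ≤-Reasoning
  rotate : ∀ w i x → w * (i * x) ≡ i * (x * w)
  rotate = solve-∀
  ind*wt : ∀ I → ind G I * wt w I ≤ W * ind G I
  ind*wt I with independent? G I
  ... | yes indI = ≤-trans (≤-reflexive (trans (cong (_* wt w I) (ind-yes G indI)) (*-identityˡ _)))
    (≤-trans (max I indI) (≤-reflexive (sym (trans (cong (W *_) (ind-yes G indI)) (*-identityʳ W)))))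
  ... | no ¬indI = ≤-trans (≤-reflexive (cong (_* wt w I) (ind-no G ¬indI))) z≤n
  each : ∀ I → I ⊆ H → sum (λ v → w v * (ind G I * 𝟙 (lookup I v))) ≤ W * ind G I
  each I _ = ≤-trans (≤-reflexive (trans (sum-cong-≗ λ v → rotate (w v) (ind G I) _)
    (sym (*-distribˡ-sum (ind G I) (λ v → 𝟙 (lookup I v) * w v))))) (ind*wt I)

module _ {n} (G : Graph n) (tf : TriangleFree G) (l : ℕ)
         (w : Fin n → ℕ) (W : ℕ) (max : ∀ I → Independent G I → wt w I ≤ W) where

  -- A greedy fractional colouring with demands c, read dually: sampling from the
  -- independent subsets of supp c until some demand c m is exhausted leaves the
  -- (rescaled) demands c′, and each unit of sampling lowers every load by at least l.
  fractional-bound : ∀ k c K → ∣ supp c ∣ ≤ k → (∀ v → 0 < c v → load G l c v ≤ K) →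
    l * sum (λ v → w v * c v) ≤ W * K
  fractional-bound k c K supp≤k load≤K
    -- Vertices are ordered by the ratio of `c v` to `N v`, the number of sampled sets through `v`;
    -- the smallest ratio marks the demand exhausted first.
    with minimum {P = λ v → 0 < c v} {R = λ u v → c u * N v ≤ c v * N u} (λ v → 1 ≤? c v)
           (λ u v → ≤-total (c u * N v) (c v * N u)) ratio-trans
    where
    N : Fin n → ℕ
    N = indepCountAt G (supp c)
    ratio-trans : ∀ {u v x} → 0 < c v → c u * N v ≤ c v * N u → c v * N x ≤ c x * N v → c u * N x ≤ c x * N u
    ratio-trans {u} {v} {x} 0<cv uv vx = *-cancelˡ-≤ (N v) {{>-nonZero (indepCountAt>0 G (supp c) (∈-supp⁺ c 0<cv))}} (begin
      N v * (c u * N x)   ≡⟨ shift (N v) (c u) (N x) ⟩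
      c u * N v * N x     ≤⟨ *-monoˡ-≤ (N x) uv ⟩
      c v * N u * N x     ≡⟨ shift′ (c v) (N u) (N x) ⟩
      N u * (c v * N x)   ≤⟨ *-monoʳ-≤ (N u) vx ⟩
      N u * (c x * N v)   ≡⟨ shift″ (N u) (c x) (N v) ⟩
      N v * (c x * N u)   ∎)
      where
      open ≤-Reasoning
      shift : ∀ a b c → a * (b * c) ≡ b * a * c
      shift = solve-∀
      shift′ : ∀ a b c → a * b * c ≡ b * (a * c)
      shift′ = solve-∀
      shift″ : ∀ a b c → a * (b * c) ≡ c * (b * a)
      shift″ = solve-∀
  ... | inj₁ none = ≤-trans (≤-reflexive (trans (cong (l *_) sum≡0) (*-zeroʳ l))) z≤n
    where
    sum≡0 : sum (λ v → w v * c v) ≡ 0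
    sum≡0 = trans (sum-cong-≗ λ v → trans (cong (w v *_) (n≤0⇒n≡0 (≮⇒≥ (none v)))) (*-zeroʳ (w v)))
                  (trans (sum-const n 0) (*-zeroʳ n))
  fractional-bound zero c K supp≤k load≤K | inj₂ (m , 0<cm , _) = contradiction
    (≤-trans (≤-reflexive (sym (∣⁅x⁆∣≡1 m))) (≤-trans
      (p⊆q⇒∣p∣≤∣q∣ λ x∈ → subst (_∈ supp c) (sym (x∈⁅y⁆⇒x≡y m x∈)) (∈-supp⁺ c 0<cm))
      supp≤k)) λ ()
  fractional-bound (suc k) c K supp≤k load≤K | inj₂ (m , 0<cm , min) =
    *-cancelˡ-≤ (N m) {{>-nonZero (indepCountAt>0 G H (∈-supp⁺ c 0<cm))}} (begin
      N m * (l * Σc)                       ≡⟨ swap (N m) l Σc ⟩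
      l * (N m * Σc)                       ≡⟨ cong (l *_) (sum-combine w c c′ N (c m) (N m) split) ⟨
      l * (Σc′ + c m * ΣN)                 ≡⟨ *-distribˡ-+ l Σc′ (c m * ΣN) ⟩
      l * Σc′ + l * (c m * ΣN)             ≤⟨ +-mono-≤ (fractional-bound k c′ K′ shrink load′≤K′)
                                                (*-monoʳ-≤ l (*-monoʳ-≤ (c m) (average-weight G H w W max))) ⟩
      W * K′ + l * (c m * (W * Z))         ≡⟨ collect W K′ l (c m) Z ⟩
      W * (K′ + c m * (l * Z))
        ≡⟨ cong (W *_) (m∸n+n≡m (≤-trans (m≤n+m _ (load G l c′ m)) (step m 0<cm))) ⟩
      W * (N m * K)                        ≡⟨ swap W (N m) K ⟩
      N m * (W * K)                        ∎)
    where
    open ≤-Reasoning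
    H = supp c
    N = indepCountAt G H
    Z = indepCount G H
    -- What sampling at rate c m / N m leaves of the demands, scaled by `N m` to stay integral. By
    -- `min′` the subtraction never truncates.
    c′ : Fin n → ℕ
    c′ v = N m * c v ∸ c m * N v
    K′ = N m * K ∸ c m * (l * Z)
    Σc = sum (λ v → w v * c v)
    Σc′ = sum (λ v → w v * c′ v)
    ΣN = sum (λ v → w v * N v)
    swap : ∀ a b c → a * (b * c) ≡ b * (a * c)
    swap = solve-∀
    collect : ∀ W K l c Z → W * K + l * (c * (W * Z)) ≡ W * (K + c * (l * Z))
    collect = solve-∀
    -- Minimality of `m` covers the support; off it `N v` is zero, since the sampled sets lie in
    -- `supp c`.
    min′ : ∀ v → c m * N v ≤ N m * c v
    min′ v with 1 ≤? c v
    ... | yes 0<cv = ≤-trans (min v 0<cv) (≤-reflexive (*-comm (c v) (N m)))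
    ... | no  0≮cv rewrite indepCountAt-∉ G H {v} (0≮cv ∘ ∈-supp⁻ c) | *-zeroʳ (c m) = z≤n
    split : ∀ v → c′ v + c m * N v ≡ N m * c v
    split v = m∸n+n≡m (min′ v)
    c′>0⇒c>0 : ∀ {v} → 0 < c′ v → 0 < c v
    c′>0⇒c>0 {v} 0<c′ with c v
    ... | suc _ = s≤s z≤n
    ... | zero rewrite *-zeroʳ (N m) | 0∸n≡0 (c m * N v) = 0<c′
    -- The local bound is available only at vertices of `H`, which is why loads are controlled only
    -- where the demand is positive.
    step : ∀ v → 0 < c v → load G l c′ v + c m * (l * Z) ≤ N m * K
    step v 0<cv = begin
      load G l c′ v + c m * (l * Z)
        ≤⟨ +-monoʳ-≤ (load G l c′ v) (*-monoʳ-≤ (c m) (Local.local-bound G tf H (∈-supp⁺ c 0<cv) l)) ⟩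
      load G l c′ v + c m * load G l N v     ≡⟨ load-combine G l c c′ N (c m) (N m) split v ⟩
      N m * load G l c v                     ≤⟨ *-monoʳ-≤ (N m) (load≤K v 0<cv) ⟩
      N m * K                                ∎
    load′≤K′ : ∀ v → 0 < c′ v → load G l c′ v ≤ K′
    load′≤K′ v 0<c′ = m+n≤o⇒m≤o∸n (load G l c′ v) (step v (c′>0⇒c>0 0<c′))
    -- The demand at `m` is now zero, so the support loses `m` and the induction on `k` advances.
    shrink : ∣ supp c′ ∣ ≤ k
    shrink = ≤-pred (≤-trans (p⊂q⇒∣p∣<∣q∣ {p = supp c′} {q = H}
      ((λ x∈ → ∈-supp⁺ c (c′>0⇒c>0 (∈-supp⁻ c′ x∈))) , m , ∈-supp⁺ c 0<cm ,
        λ m∈ → <-irrefl (sym (m≤n⇒m∸n≡0 (≤-reflexive (*-comm (N m) (c m))))) (∈-supp⁻ c′ m∈))) supp≤k)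

-- Independent sets of large weight under a degree bound

wt≤sum : ∀ {n} (w : Fin n → ℕ) I → wt w I ≤ sum w
wt≤sum w I = sum-mono-≤ pointwise
  where
  pointwise : ∀ u → 𝟙 (lookup I u) * w u ≤ w u
  pointwise u with lookup I u
  ... | true  = ≤-reflexive (+-identityʳ _)
  ... | false = z≤n

-- The upper bound starts at the total weight and is lowered until some independent set attains it.
heaviest : ∀ {n} (G : Graph n) w → ∃ λ I → Independent G I × (∀ J → Independent G J → wt w J ≤ wt w I)
heaviest G w = descend (sum w) λ J _ → wt≤sum w J
  where
  descend : ∀ W → (∀ J → Independent G J → wt w J ≤ W) →
    ∃ λ I → Independent G I × (∀ J → Independent G J → wt w J ≤ wt w I)
  descend zero    h = ⊥ , Independent-⊥ G , λ J indJ → ≤-trans (h J indJ) z≤n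
  descend (suc W) h with anySubset? (λ I → independent? G I ×-dec (suc W ≤? wt w I))
  ... | yes (I , indI , W<) = I , indI , λ J indJ → ≤-trans (h J indJ) W<
  ... | no  none            = descend W λ J indJ → ≤-pred (≰⇒> λ W< → none (J , indJ , W<))

module _ {n} (G : Graph n) (tf : TriangleFree G) (l Δ : ℕ) (2^l≤Δ : 2 ^ l ≤ Δ)
         (deg≤Δ : ∀ v → sum (λ u → 𝟙 (adj G v u)) ≤ Δ) where

  -- With all demands equal to 1 the load at `v` is 2·2^l + 2·deg v, hence at most 4Δ.
  heavy-independent : ∀ w → ∃ λ I → Independent G I × l * sum w ≤ wt w I * (4 * Δ)
  heavy-independent w with I , indI , max ← heaviest G w = I , indI , (begin
    l * sum w                     ≡⟨ cong (l *_) (sum-cong-≗ λ v → sym (*-identityʳ (w v))) ⟩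
    l * sum (λ v → w v * 1)
      ≤⟨ fractional-bound G tf l w (wt w I) max _ (const 1) (4 * Δ) ≤-refl (λ v _ → load≤ v) ⟩
    wt w I * (4 * Δ)              ∎)
    where
    open ≤-Reasoning
    collect : ∀ d → 2 * d * 1 + 2 * d ≡ 4 * d
    collect = solve-∀
    load≤ : ∀ v → load G l (const 1) v ≤ 4 * Δ
    load≤ v = ≤-trans
      (+-mono-≤ (*-monoˡ-≤ 1 (*-monoʳ-≤ 2 2^l≤Δ))
        (*-monoʳ-≤ 2 (≤-trans (≤-reflexive (sum-cong-≗ λ u → *-identityʳ (𝟙 (adj G v u)))) (deg≤Δ v))))
      (≤-reflexive (collect Δ))

  -- The same bound for the signed weight a − b, without subtraction.
  heavy-independent-signed : ∀ (a b : Fin n → ℕ) → ∃ λ I → Independent G I ×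
    l * sum a + 4 * Δ * wt b I ≤ l * sum b + 4 * Δ * wt a I
  heavy-independent-signed a b with I , indI , heavy ← heavy-independent (λ v → a v ∸ b v) =
    I′ , Independent-⊆ G (p∩q⊆p I (supp w)) indI , (begin
      l * sum a + 4 * Δ * wt b I′                          ≤⟨ +-monoˡ-≤ _ (*-monoʳ-≤ l sum-a≤) ⟩
      l * (sum b + sum w) + 4 * Δ * wt b I′
        ≡⟨ cong (_+ 4 * Δ * wt b I′) (*-distribˡ-+ l (sum b) (sum w)) ⟩
      l * sum b + l * sum w + 4 * Δ * wt b I′
        ≤⟨ +-monoˡ-≤ _ (+-monoʳ-≤ (l * sum b) (≤-trans heavy (*-monoˡ-≤ (4 * Δ) w-I≤))) ⟩
      l * sum b + wt w I′ * (4 * Δ) + 4 * Δ * wt b I′      ≡⟨ collect (l * sum b) (wt w I′) (4 * Δ) (wt b I′) ⟩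
      l * sum b + 4 * Δ * (wt w I′ + wt b I′)              ≡⟨ cong (λ z → l * sum b + 4 * Δ * z) w+b≡a ⟩
      l * sum b + 4 * Δ * wt a I′                          ∎)
    where
    open ≤-Reasoning
    w : Fin n → ℕ
    w v = a v ∸ b v
    -- Discarding the vertices with a ≤ b costs no weight and makes `a v ∸ b v` a true difference on
    -- what remains.
    I′ = I ∩ supp w
    collect : ∀ s x d y → s + x * d + d * y ≡ s + d * (x + y)
    collect = solve-∀
    sum-a≤ : sum a ≤ sum b + sum w
    sum-a≤ = ≤-trans (sum-mono-≤ λ v → m≤n+m∸n (a v) (b v)) (≤-reflexive (∑-distrib-+ b w))
    w-I≤ : wt w I ≤ wt w I′
    w-I≤ = sum-mono-≤ pointwise
      where
      pointwise : ∀ v → 𝟙 (lookup I v) * w v ≤ 𝟙 (lookup I′ v) * w v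
      pointwise v with 1 ≤? w v
      ... | yes 0<w = *-monoˡ-≤ (w v) (𝟙-mono I I′ v λ v∈I → x∈p∩q⁺ (v∈I , ∈-supp⁺ w 0<w))
      ... | no  0≮w rewrite n≤0⇒n≡0 (≮⇒≥ 0≮w) | *-zeroʳ (𝟙 (lookup I v)) = z≤n
    w+b≡a : wt w I′ + wt b I′ ≡ wt a I′
    w+b≡a = trans (sym (∑-distrib-+ (λ v → 𝟙 (lookup I′ v) * w v) (λ v → 𝟙 (lookup I′ v) * b v))) (sum-cong-≗ pointwise)
      where
      pointwise : ∀ v → 𝟙 (lookup I′ v) * w v + 𝟙 (lookup I′ v) * b v ≡ 𝟙 (lookup I′ v) * a v
      pointwise v with lookup I′ v in eq
      ... | false = refl
      ... | true  = trans (sym (*-distribˡ-+ 1 (w v) (b v))) (cong (1 *_) (m∸n+n≡m {a v} {b v}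
        (<⇒≤ (m∸n≢0⇒n<m (n>0⇒n≢0 (∈-supp⁻ w (p∩q⊆q I (supp w) (lookup⇒[]= v I′ eq))))))))

-- Dense induced bipartite subgraphs

deg≡sum : ∀ {n} (G : Graph n) v → deg G v ≡ sum (λ u → 𝟙 (adj G v u))
deg≡sum G v = sum-map-allFin (λ u → 𝟙 (adj G v u))

deg≤maxDeg : ∀ {n} (G : Graph n) v → deg G v ≤ maxDeg G
deg≤maxDeg G v = ≤-trans (go (deg G) v) (≤-reflexive (cong (foldr _⊔_ 0) (sym (map-tabulate id (deg G)))))
  where
  go : ∀ {m} (f : Fin m → ℕ) i → f i ≤ foldr _⊔_ 0 (tabulateL f)
  go f zero    = m≤m⊔n _ _
  go f (suc i) = ≤-trans (go (f ∘ suc) i) (m≤n⊔m (f zero) _)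

wt-* : ∀ {n} k (f : Fin n → ℕ) I → wt (λ u → k * f u) I ≡ k * wt f I
wt-* k f I = trans (sum-cong-≗ λ u → swap (𝟙 (lookup I u)) k (f u)) (sym (*-distribˡ-sum k (λ u → 𝟙 (lookup I u) * f u)))
  where
  swap : ∀ a b c → a * (b * c) ≡ b * (a * c)
  swap = solve-∀

wt-const : ∀ {n} k (I : Subset n) → wt (const k) I ≡ k * ∣ I ∣
wt-const k I = trans (sum-cong-≗ λ u → *-comm (𝟙 (lookup I u)) k)
  (trans (sym (*-distribˡ-sum k (𝟙 ∘ lookup I))) (cong (k *_) (sym (∣∣≡sum I))))

-- Only degrees from `J` into `I` are counted; degrees within the union dominate them.
wt-degIn≤degSumIn : ∀ {n} (G : Graph n) I J → wt (λ v → wt (𝟙 ∘ adj G v) I) J ≤ degSumIn G (I ∪ J)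
wt-degIn≤degSumIn G I J = ≤-trans (sum-mono-≤ outer)
  (≤-reflexive (sym (sum-map-allFin λ v → if lookup (I ∪ J) v then degIn G (I ∪ J) v else 0)))
  where
  inner : ∀ v u → 𝟙 (lookup I u) * 𝟙 (adj G v u) ≤ (if lookup (I ∪ J) u then 𝟙 (adj G v u) else 0)
  inner v u with lookup I u in eq
  ... | false = z≤n
  ... | true rewrite []=⇒lookup (p⊆p∪q J (lookup⇒[]= u I eq)) = ≤-reflexive (+-identityʳ _)
  outer : ∀ v → 𝟙 (lookup J v) * wt (𝟙 ∘ adj G v) I ≤ (if lookup (I ∪ J) v then degIn G (I ∪ J) v else 0)
  outer v with lookup J v in eq
  ... | false = z≤n
  ... | true rewrite []=⇒lookup (q⊆p∪q I J (lookup⇒[]= v J eq)) =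
    ≤-trans (≤-reflexive (+-identityʳ _)) (≤-trans (sum-mono-≤ (inner v))
      (≤-reflexive (sym (sum-map-allFin λ u → if lookup (I ∪ J) u then 𝟙 (adj G v u) else 0))))

-- Double counting of adjacent pairs with one end in `I`.
sum-degIn : ∀ {n} (G : Graph n) I → sum (λ v → wt (𝟙 ∘ adj G v) I) ≡ wt (λ u → sum (𝟙 ∘ adj G u)) I
sum-degIn G I = trans (∑-comm (λ v u → 𝟙 (lookup I u) * 𝟙 (adj G v u)))
  (sum-cong-≗ λ u → trans (sum-cong-≗ λ v → cong (λ b → 𝟙 (lookup I u) * 𝟙 b) (adj-sym G v u))
    (sym (*-distribˡ-sum (𝟙 (lookup I u)) (λ v → 𝟙 (adj G u v)))))

∣p∪q∣≤∣p∣+∣q∣ : ∀ {n} (p q : Subset n) → ∣ p ∪ q ∣ ≤ ∣ p ∣ + ∣ q ∣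
∣p∪q∣≤∣p∣+∣q∣ []          []          = z≤n
∣p∪q∣≤∣p∣+∣q∣ (true ∷ p)  (true ∷ q)  = s≤s (≤-trans (∣p∪q∣≤∣p∣+∣q∣ p q) (+-monoʳ-≤ ∣ p ∣ (n≤1+n _)))
∣p∪q∣≤∣p∣+∣q∣ (true ∷ p)  (false ∷ q) = s≤s (∣p∪q∣≤∣p∣+∣q∣ p q)
∣p∪q∣≤∣p∣+∣q∣ (false ∷ p) (true ∷ q)  = ≤-trans (s≤s (∣p∪q∣≤∣p∣+∣q∣ p q)) (≤-reflexive (sym (+-suc _ _)))
∣p∪q∣≤∣p∣+∣q∣ (false ∷ p) (false ∷ q) = ∣p∪q∣≤∣p∣+∣q∣ p q

-- Coloured by membership in `I`: vertices of the union outside `I` lie in `J`, so an overlap does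
-- no harm.
Independent-∪-bipartite : ∀ {n} (G : Graph n) I J → Independent G I → Independent G J → InducedBipartite G (I ∪ J)
Independent-∪-bipartite G I J indI indJ = lookup I , proper
  where
  outside-I : ∀ {x} → x ∈ I ∪ J → lookup I x ≡ false → x ∈ J
  outside-I x∈ x∉I with x∈p∪q⁻ I J x∈
  ... | inj₁ x∈I = contradiction (trans (sym ([]=⇒lookup x∈I)) x∉I) λ ()
  ... | inj₂ x∈J = x∈J
  proper : ∀ u v → u ∈ I ∪ J → v ∈ I ∪ J → adj G u v ≡ true → ¬ (lookup I u ≡ lookup I v)
  proper u v u∈ v∈ uv same with lookup I u in eq
  ... | true  = contradiction (trans (sym uv) (indI u v (lookup⇒[]= u I eq) (lookup⇒[]= v I (sym same)))) λ ()
  ... | false = contradiction (trans (sym uv) (indJ u v (outside-I u∈ eq) (outside-I v∈ (sym same)))) λ ()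

-- Here `i` is ∣I∣ and `E` the degree sum over `I`. The weights 8m·deg total 8mD and the thresholds
-- 4D total 4mD; the surplus 4mD, divided by 4, gives the first term.
first-step : ∀ l m D Δ i E → l * (8 * m * D) + 4 * Δ * (4 * D * i) ≤ l * (m * (4 * D)) + 4 * Δ * (8 * m * E) →
  l * m * D + 4 * Δ * D * i ≤ 8 * Δ * m * E
first-step l m D Δ i E h = *-cancelˡ-≤ 4 (+-cancelˡ-≤ (l * (m * (4 * D))) _ _
  (≤-trans (≤-reflexive (lhs l m D Δ i)) (≤-trans h (≤-reflexive (rhs l m D Δ E)))))
  where
  lhs : ∀ l m D Δ i → l * (m * (4 * D)) + 4 * (l * m * D + 4 * Δ * D * i) ≡ l * (8 * m * D) + 4 * Δ * (4 * D * i)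
  lhs = solve-∀
  rhs : ∀ l m D Δ E → l * (m * (4 * D)) + 4 * Δ * (8 * m * E) ≡ l * (m * (4 * D)) + 4 * (8 * Δ * m * E)
  rhs = solve-∀

-- Multiplied by l, the term l·m·D of the first bound pays exactly for the thresholds D·l of the
-- second weight, and the term in `i` becomes the share of ∣I∣ in the density bound.
second-step : ∀ l m D Δ i j E F → 0 < Δ → l * m * D + 4 * Δ * D * i ≤ 8 * Δ * m * E →
  l * (8 * m * Δ * E) + 4 * Δ * (D * l * j) ≤ l * (m * (D * l)) + 4 * Δ * (8 * m * Δ * F) →
  D * l * (i + j) ≤ 8 * m * Δ * F
second-step l m D Δ@(suc _) i j E F _ h₁ h₂ = *-cancelˡ-≤ (4 * Δ) (+-cancelˡ-≤ (l * (m * (D * l))) _ _ (begin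
  l * (m * (D * l)) + 4 * Δ * (D * l * (i + j))                ≡⟨ expand l m D Δ i j ⟩
  l * (l * m * D + 4 * Δ * D * i) + 4 * Δ * (D * l * j)
    ≤⟨ +-monoˡ-≤ (4 * Δ * (D * l * j)) (*-monoʳ-≤ l h₁) ⟩
  l * (8 * Δ * m * E) + 4 * Δ * (D * l * j)
    ≡⟨ cong (λ z → l * (z * E) + 4 * Δ * (D * l * j)) (swap Δ m) ⟩
  l * (8 * m * Δ * E) + 4 * Δ * (D * l * j)                    ≤⟨ h₂ ⟩
  l * (m * (D * l)) + 4 * Δ * (8 * m * Δ * F)                  ∎))
  where
  open ≤-Reasoning
  expand : ∀ l m D Δ i j → l * (m * (D * l)) + 4 * Δ * (D * l * (i + j))
    ≡ l * (l * m * D + 4 * Δ * D * i) + 4 * Δ * (D * l * j)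
  expand = solve-∀
  swap : ∀ Δ m → 8 * Δ * m ≡ 8 * m * Δ
  swap = solve-∀

module _ {m} (G : Graph m) .{{_ : NonZero m}} (tf : TriangleFree G) (l Δ D : ℕ) (2^l≤Δ : 2 ^ l ≤ Δ)
         (δ≤Δ : ∀ v → sum (𝟙 ∘ adj G v) ≤ Δ) (sum-δ : sum (λ v → sum (𝟙 ∘ adj G v)) ≡ D) (lD>0 : 1 ≤ l * D) where

  private
    δ : Fin m → ℕ
    δ v = sum (𝟙 ∘ adj G v)

    module Pair (I J : Subset m)
      (hI : l * sum (λ u → 8 * m * δ u) + 4 * Δ * wt (const (4 * D)) I
          ≤ l * sum {m} (const (4 * D)) + 4 * Δ * wt (λ u → 8 * m * δ u) I)
      (hJ : l * sum (λ v → 8 * m * Δ * wt (𝟙 ∘ adj G v) I) + 4 * Δ * wt (const (D * l)) J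
          ≤ l * sum {m} (const (D * l)) + 4 * Δ * wt (λ v → 8 * m * Δ * wt (𝟙 ∘ adj G v) I) J) where
      open ≤-Reasoning
      E = wt δ I
      e : Fin m → ℕ
      e v = wt (𝟙 ∘ adj G v) I
      F = wt e J

      reorder : ∀ m Δ s → 8 * m * Δ * s ≡ s * m * 8 * Δ
      reorder = solve-∀

      h₁ : l * m * D + 4 * Δ * D * ∣ I ∣ ≤ 8 * Δ * m * E
      h₁ = first-step l m D Δ ∣ I ∣ E (begin
        l * (8 * m * D) + 4 * Δ * (4 * D * ∣ I ∣)
          ≡⟨ cong₂ (λ y z → l * y + 4 * Δ * z)
            (trans (cong (8 * m *_) (sym sum-δ)) (*-distribˡ-sum (8 * m) δ))
            (sym (wt-const (4 * D) I)) ⟩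
        l * sum (λ u → 8 * m * δ u) + 4 * Δ * wt (const (4 * D)) I       ≤⟨ hI ⟩
        l * sum {m} (const (4 * D)) + 4 * Δ * wt (λ u → 8 * m * δ u) I
          ≡⟨ cong₂ (λ y z → l * y + 4 * Δ * z) (sum-const m (4 * D)) (wt-* (8 * m) δ I) ⟩
        l * (m * (4 * D)) + 4 * Δ * (8 * m * E)                          ∎)

      h₂ : l * (8 * m * Δ * E) + 4 * Δ * (D * l * ∣ J ∣) ≤ l * (m * (D * l)) + 4 * Δ * (8 * m * Δ * F)
      h₂ = begin
        l * (8 * m * Δ * E) + 4 * Δ * (D * l * ∣ J ∣)
          ≡⟨ cong₂ (λ y z → l * y + 4 * Δ * z)
            (trans (cong (8 * m * Δ *_) (sym (sum-degIn G I))) (*-distribˡ-sum (8 * m * Δ) e))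
            (sym (wt-const (D * l) J)) ⟩
        l * sum (λ v → 8 * m * Δ * e v) + 4 * Δ * wt (const (D * l)) J   ≤⟨ hJ ⟩
        l * sum {m} (const (D * l)) + 4 * Δ * wt (λ v → 8 * m * Δ * e v) J
          ≡⟨ cong₂ (λ y z → l * y + 4 * Δ * z) (sum-const m (D * l)) (wt-* (8 * m * Δ) e J) ⟩
        l * (m * (D * l)) + 4 * Δ * (8 * m * Δ * F)                      ∎

      -- Since `E` is at most Δ·∣I∣, an empty `I` would make it zero, while `h₁` and l·D ≥ 1 force
      -- it to be positive.
      I>0 : 1 ≤ ∣ I ∣
      I>0 = n≢0⇒n>0 λ I≡0 → contradiction (begin
        1                             ≤⟨ lD>0 ⟩
        l * D                         ≤⟨ m≤n*m (l * D) m ⟩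
        m * (l * D)                   ≡⟨ rotate m l D ⟩
        l * m * D                     ≤⟨ m≤m+n _ _ ⟩
        l * m * D + 4 * Δ * D * ∣ I ∣ ≤⟨ h₁ ⟩
        8 * Δ * m * E
          ≤⟨ *-monoʳ-≤ (8 * Δ * m) (sum-mono-≤ λ u → *-monoʳ-≤ (𝟙 (lookup I u)) (δ≤Δ u)) ⟩
        8 * Δ * m * wt (const Δ) I
          ≡⟨ cong (8 * Δ * m *_) (trans (wt-const Δ I) (trans (cong (Δ *_) I≡0) (*-zeroʳ Δ))) ⟩
        8 * Δ * m * 0                 ≡⟨ *-zeroʳ (8 * Δ * m) ⟩
        0                             ∎) λ ()
        where
        rotate : ∀ m l D → m * (l * D) ≡ l * m * D
        rotate = solve-∀

      dense : D * l * ∣ I ∪ J ∣ ≤ degSumIn G (I ∪ J) * m * 8 * Δ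
      dense = begin
        D * l * ∣ I ∪ J ∣              ≤⟨ *-monoʳ-≤ (D * l) (∣p∪q∣≤∣p∣+∣q∣ I J) ⟩
        D * l * (∣ I ∣ + ∣ J ∣)        ≤⟨ second-step l m D Δ ∣ I ∣ ∣ J ∣ E F (≤-trans (m^n>0 2 l) 2^l≤Δ) h₁ h₂ ⟩
        8 * m * Δ * F                  ≤⟨ *-monoʳ-≤ (8 * m * Δ) (wt-degIn≤degSumIn G I J) ⟩
        8 * m * Δ * degSumIn G (I ∪ J) ≡⟨ reorder m Δ (degSumIn G (I ∪ J)) ⟩
        degSumIn G (I ∪ J) * m * 8 * Δ ∎

  dense-bipartite : Σ (Subset m) λ S → 1 ≤ ∣ S ∣ × InducedBipartite G S × D * l * ∣ S ∣ ≤ degSumIn G S * m * 8 * Δ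
  dense-bipartite =
    -- The signed weight is positive exactly where the degree exceeds half the average D/m.
    let I , indI , hI = heavy-independent-signed G tf l Δ 2^l≤Δ δ≤Δ (λ u → 8 * m * δ u) (const (4 * D))
        -- The number of neighbours in `I` is now measured against D·l/(8mΔ), the average degree to
        -- be reached.
        J , indJ , hJ = heavy-independent-signed G tf l Δ 2^l≤Δ δ≤Δ
                          (λ v → 8 * m * Δ * wt (𝟙 ∘ adj G v) I) (const (D * l))
    in I ∪ J , ≤-trans (Pair.I>0 I J hI hJ) (∣p∣≤∣p∪q∣ I J) ,
       Independent-∪-bipartite G I J indI indJ , Pair.dense I J hI hJ

-- Cleared of denominators, with average degrees D/n and `degSumIn G S` over ∣S∣. For Δ ≥ 2, log Δ ≤
-- log₂ Δ ≤ 2·⌊log₂ Δ⌋, so replacing the natural logarithm by `⌊log₂_⌋` changes only the constant.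
theorem3p3 : Σ ℕ λ C → 1 ≤ C ×
    (∀ n (G : Graph (suc n)) → TriangleFree G →
    Σ (Subset (suc n)) λ S → 1 ≤ ∣ S ∣ × InducedBipartite G S ×
    degSum G * ⌊log₂ maxDeg G ⌋ * ∣ S ∣ ≤ degSumIn G S * (suc n) * C * maxDeg G)
theorem3p3 = 8 , s≤s z≤n , bipartite
  where
  bipartite : ∀ n (G : Graph (suc n)) → TriangleFree G →
    Σ (Subset (suc n)) λ S → 1 ≤ ∣ S ∣ × InducedBipartite G S ×
    degSum G * ⌊log₂ maxDeg G ⌋ * ∣ S ∣ ≤ degSumIn G S * (suc n) * 8 * maxDeg G
  bipartite n G tf with 1 ≤? ⌊log₂ maxDeg G ⌋ * degSum G
  -- The left side is zero here, so a single vertex suffices.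
  ... | no trivial = S₀ , ≤-reflexive (sym (∣⁅x⁆∣≡1 {suc n} zero)) ,
    ((λ _ → true) , λ u v u∈ v∈ uv → contradiction (trans (sym uv) (Independent-⁅⁆ G zero u v u∈ v∈)) λ ()) ,
    ≤-trans (≤-reflexive (cong (_* ∣ S₀ ∣) (trans (*-comm (degSum G) _) (n≤0⇒n≡0 (≮⇒≥ trivial))))) z≤n
    where
    S₀ : Subset (suc n)
    S₀ = ⁅ zero ⁆
  ... | yes lD>0 = dense-bipartite G tf ⌊log₂ maxDeg G ⌋ (maxDeg G) (degSum G)
    (2^⌊log₂n⌋≤n (maxDeg G) Δ>0)
    (λ v → ≤-trans (≤-reflexive (sym (deg≡sum G v))) (deg≤maxDeg G v))
    (trans (sum-cong-≗ λ v → sym (deg≡sum G v)) (sym (sum-map-allFin (deg G))))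
    lD>0
    where
    -- `⌊log₂ 0 ⌋` evaluates to 0, so a positive product excludes Δ = 0.
    Δ>0 : 0 < maxDeg G
    Δ>0 = n≢0⇒n>0 λ Δ≡0 → contradiction (subst (λ d → 1 ≤ ⌊log₂ d ⌋ * degSum G) Δ≡0 lD>0) λ ()
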